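{- Let $\sigma$ be an LBFS ordering of a connected graph $G$, let $(T,\mathcal F)$ be a graph-labelled tree whose accessibility graph is $G$, and let $u$ be a node of $(T,\mathcal F)$. Then $\sigma[G(u)]$ is an LBFS ordering of $G(u)$.
   Context: Graphs are finite, simple and undirected. An LBFS ordering of an $n$-vertex graph is any ordering produced as follows: all vertices start with an empty label; for $i=1,\dots,n$, choose any unnumbered vertex $v$ with lexicographically largest label, number it $i$, and append $n-i+1$ to the label of every unnumbered neighbour of $v$. A graph-labelled tree (GLT) $(T,\mathcal F)$ is a tree $T$ whose non-leaf vertices are called nodes (each of degree at least 3), where each node $u$ is labelled by a graph $G(u)\in\mathcal F$ together with a bijection $\rho_u$ from the tree-edges incident to $u$ to $V(u):=V(G(u))$. Vertices of labels are marker vertices; edges of labels are label-edges. The extremities of a tree-edge $e$ are: at an end that is a node $u$, the marker vertex $\rho_u(e)$; at an end that is a leaf, the leaf itself. Two elements (leaves or marker vertices) are accessible from one another if there is a sequence of leaves and marker vertices joining them whose consecutive elements are either the two extremities of a tree-edge or the two vertices of a label-edge, with tree-edges and label-edges alternating. The accessibility graph of the GLT has the leaves of $T$ as vertices, distinct leaves being adjacent iff accessible from one another. For a marker vertex $q\in V(u)$ corresponding to the tree-edge $e$, $L(q)$ is the set of leaves in the component of $T-e$ not containing $u$, and $A(q)$ is the set of leaves of $L(q)$ accessible from $q$ (non-empty when the accessibility graph is connected). Given an ordering $\sigma$ of the accessibility graph, for a marker vertex $p$ let $x_p$ be the earliest vertex of $A(p)$ in $\sigma$. Then $\sigma[G(u)]$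 is the ordering of $V(u)$ in which $q$ precedes $r$ if $x_q$ precedes $x_r$ in $\sigma$. -}

module Defs where

open import Data.Bool.Base using (Bool; true; false; T; if_then_else_; _∧_)
open import Data.Fin.Base as Fin using (Fin; toℕ; fromℕ<)
open import Data.List.Base using (List; []; _∷_; _∷ʳ_; length)
open import Data.List.Relation.Binary.Lex.Strict using (Lex-≤)
open import Data.List.Relation.Unary.Linked using (Linked)
open import Data.List.Relation.Unary.Unique.Propositional using (Unique)
open import Data.Nat.Base using (ℕ; zero; suc; _∸_; _≤_; _<_)
open import Data.Nat.Properties using (_<?_; <⇒≤)
open import Data.Product.Base using (Σ-syntax; ∃-syntax; _×_; _,_; proj₁)
open import Function.Bundles using (_↔_; _⇔_; Inverse)
open import Level using (0ℓ)
open import Relation.Binary.Core using (Rel)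
open import Relation.Binary.Construct.Closure.ReflexiveTransitive using (Star)
open import Relation.Binary.PropositionalEquality.Core using (_≡_; _≢_)
open import Relation.Nullary.Decidable.Core using (does)
open import Relation.Nullary.Negation.Core using (¬_)

open Inverse using (to; from)

-- Boolean-valued adjacency keeps `Adj` proof-irrelevant, so that `Neighbour v`
-- has exactly one element per edge incident to v.

record Graph (V : Set) : Set where
  field
    adj    : V → V → Bool
    sym    : ∀ x y → adj x y ≡ adj y x
    irrefl : ∀ x → adj x x ≡ false

  Adj : Rel V 0ℓ
  Adj x y = T (adj x y)

  Neighbour : V → Set
  Neighbour x = ∃[ y ] Adj x y

module _ {V : Set} (G : Graph V) where
  open Graph G

  Connected : Set
  Connected = ∀ x y → Star Adj x y

  -- A cycle is listed as x ∷ xs, without repeating its first vertex.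
  Acyclic : Set
  Acyclic = ∀ x xs → 2 ≤ length xs → Unique (x ∷ xs) →
            ¬ Linked Adj (x ∷ (xs ∷ʳ x))

  HasDegree : V → ℕ → Set
  HasDegree x d = Neighbour x ↔ Fin d

  RemoveEdge : V → V → Rel V 0ℓ
  RemoveEdge a b x y = Adj x y × ¬ (x ≡ a × y ≡ b) × ¬ (x ≡ b × y ≡ a)

_≤ₗₑₓ_ : Rel (List ℕ) 0ℓ
_≤ₗₑₓ_ = Lex-≤ _≡_ _<_

-- A numbering `num` sends each vertex to its position.  Positions start at 0:
-- the vertex numbered i = j + 1 has position j, and the entry n - i + 1 that it
-- appends to the labels of its unnumbered neighbours is n ∸ j.

module _ {n : ℕ} (G : Graph (Fin n)) where
  open Graph G

  -- The label of w once the first j vertices have been numbered.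
  lbfsLabel : Fin n ↔ Fin n → (j : ℕ) → j ≤ n → Fin n → List ℕ
  lbfsLabel num zero    _   w = []
  lbfsLabel num (suc j) j<n w =
    if does (j <? toℕ (to num w)) ∧ adj (from num (fromℕ< j<n)) w
    then previous ∷ʳ (n ∸ j)
    else previous
    where
    previous : List ℕ
    previous = lbfsLabel num j (<⇒≤ j<n) w

  -- When the vertex v is numbered, the unnumbered vertices are v itself and
  -- all those of larger position.
  IsLBFSNumbering : Fin n ↔ Fin n → Set
  IsLBFSNumbering num =
    ∀ j (j<n : j < n) w → j ≤ toℕ (to num w) →
    lbfsLabel num j (<⇒≤ j<n) w
      ≤ₗₑₓ lbfsLabel num j (<⇒≤ j<n) (from num (fromℕ< j<n))

  -- An ordering is given by its precedence relation.
  IsLBFSOrdering : Rel (Fin n) 0ℓ → Set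
  IsLBFSOrdering _≺_ =
    Σ[ num ∈ Fin n ↔ Fin n ]
      IsLBFSNumbering num × (∀ x y → x ≺ y ⇔ to num x Fin.< to num y)

data TreeVertex (n k : ℕ) : Set where
  leaf : Fin n → TreeVertex n k
  node : Fin k → TreeVertex n k

-- Graph-labelled trees with n leaves and k nodes.  A tree-edge incident to a
-- node is given by its other end.

record GLT (n k : ℕ) : Set where
  field
    tree       : Graph (TreeVertex n k)
    connected  : Connected tree
    acyclic    : Acyclic tree
    leafDegree : ∀ l → HasDegree tree (leaf l) 1
    nodeDegree : ∀ u → ∃[ d ] (3 ≤ d × HasDegree tree (node u) d)

    size  : Fin k → ℕ
    label : (u : Fin k) → Graph (Fin (size u))
    ρ     : (u : Fin k) → Graph.Neighbour tree (node u) ↔ Fin (size u)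

  open Graph tree using (Adj)

  data Element : Set where
    leaf   : Fin n → Element
    marker : (u : Fin k) → Fin (size u) → Element

  -- The extremity, at the end a, of the tree-edge ab.
  extremity : ∀ a b → Adj a b → Element
  extremity (leaf l) b e = leaf l
  extremity (node u) b e = marker u (to (ρ u) (b , e))

  data Kind : Set where
    treeEdge labelEdge : Kind

  other : Kind → Kind
  other treeEdge  = labelEdge
  other labelEdge = treeEdge

  data Step : Kind → Rel Element 0ℓ where
    along  : ∀ {a b} (e : Adj a b) (e′ : Adj b a) →
             Step treeEdge (extremity a b e) (extremity b a e′)
    within : ∀ {u q r} → Graph.Adj (label u) q r →
             Step labelEdge (marker u q) (marker u r)

  -- Alternating sequences; the index is the kind of the first step.
  data Alternating : Kind → Rel Element 0ℓ where
    []  : ∀ {κ x} → Alternating κ x x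
    _∷_ : ∀ {κ x y z} → Step κ x y → Alternating (other κ) y z →
          Alternating κ x z

  Accessible : Rel Element 0ℓ
  Accessible x y = ∃[ κ ] Alternating κ x y

  -- l ∈ L(q), for a marker vertex q of u: in T - e, where e is the tree-edge of
  -- q, the component of l does not contain u.
  L : (u : Fin k) → Fin (size u) → Fin n → Set
  L u q l =
    ¬ Star (RemoveEdge tree (node u) (proj₁ (from (ρ u) q))) (leaf l) (node u)

  A : (u : Fin k) → Fin (size u) → Fin n → Set
  A u q l = L u q l × Accessible (marker u q) (leaf l)

  module _ (_≺_ : Rel (Fin n) 0ℓ) where

    -- x is the vertex x_q.
    Earliest : (u : Fin k) → Fin (size u) → Fin n → Set
    Earliest u q x = A u q x × (∀ y → A u q y → y ≢ x → x ≺ y)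

    -- The ordering σ[G(u)], where σ is _≺_.
    induced : (u : Fin k) → Rel (Fin (size u)) 0ℓ
    induced u q r =
      ∃[ x ] ∃[ y ] (Earliest u q x × Earliest u r y × x ≺ y)

IsAccessibilityGraph : ∀ {n k} → GLT n k → Graph (Fin n) → Set
IsAccessibilityGraph Γ G =
  ∀ x y → Graph.Adj G x y ⇔ (x ≢ y × Accessible (leaf x) (leaf y))
  where open GLT Γ

{-# OPTIONS --safe #-}

-- A vertex ordering is LBFS iff a < b < c, ac ∈ E and ab ∉ E imply that some
-- d < a is adjacent to b and not to c.  For markers a < b < c of u as above, the
-- vertices x_a < x_b < x_c of G satisfy the same hypothesis and yield d < x_a
-- adjacent to x_b and not to x_c.  If d ∈ L(q) with q ≠ b, then d ∈ A(q), and q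
-- is the required marker, since x_q ≤ d.  The case q = b is impossible: the
-- vertices numbered before x_b induce a connected graph that contains no vertex
-- of A(b), whereas x_a ∉ L(b) is among them.

module Submission where

open import Defs
open import Data.Bool.Base using (Bool; true; false; T; if_then_else_)
open import Data.Bool.Properties using (T?; T-irrelevant)
open import Data.Fin.Base as Fin using (Fin; zero; suc; toℕ; fromℕ<; join; punchOut; splitAt)
open import Data.Fin.Properties
  using (_≟_; any?; injective⇒≤; punchOut-injective; splitAt-join; toℕ-fromℕ<; toℕ-injective; toℕ<n)
open import Data.Fin.Subset using (Subset; _∈_; ∣_∣)
open import Data.Fin.Subset.Properties using (p⊂q⇒∣p∣<∣q∣; ∣⊤∣≡n; ∈⊤)
open import Data.List.Base using (List; []; _∷_; _++_; _∷ʳ_; length; lookup)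
open import Data.List.Membership.Propositional using () renaming (_∈_ to _∈ₗ_)
open import Data.List.Membership.Propositional.Properties using (∈-∃++; ∈-lookup)
open import Data.List.Relation.Binary.Lex.Core using (base; halt; this; next)
open import Data.List.Relation.Unary.All as All using ([]; _∷_)
open import Data.List.Relation.Unary.All.Properties using (¬Any⇒All¬; ++⁻)
open import Data.List.Relation.Unary.AllPairs using ([]; _∷_)
open import Data.List.Relation.Unary.Any using (here; there)
open import Data.List.Relation.Unary.Linked using (Linked; [-]; _∷_)
open import Data.List.Relation.Unary.Unique.Propositional using (Unique)
open import Data.Nat.Base using (ℕ; zero; suc; _+_; _∸_; _≤_; _<_; s≤s; z≤n)
open import Data.Nat.Induction using (<-wellFounded)
open import Data.Nat.Properties renaming (_≟_ to _≟ⁿ_)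
open import Data.Product.Base using (∃-syntax; _×_; _,_; proj₁; proj₂)
open import Data.Sum.Base using (_⊎_; inj₁; inj₂)
open import Data.Unit.Base using (tt)
open import Data.Vec.Base using (tabulate)
open import Data.Vec.Properties using ([]=⇒lookup; lookup⇒[]=; lookup∘tabulate)
open import Function.Base using (_∘_)
open import Function.Bundles using (_↔_; _⇔_; mk⇔; mk↔ₛ′; Equivalence; Injection; Inverse)
open import Function.Definitions using (Injective)
open import Function.Properties.Inverse using (↔⇒↣; ↔-sym)
open import Induction.WellFounded using (Acc; acc)
open import Level using (0ℓ)
open import Relation.Binary.Construct.Closure.ReflexiveTransitive using (Star; ε; _◅_)
open import Relation.Binary.Core using (Rel)
open import Relation.Binary.Definitions using (DecidableEquality; tri<; tri≈; tri>)
open import Relation.Binary.PropositionalEquality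
open import Relation.Nullary using (¬_; yes; no; does; contradiction)
open import Relation.Nullary.Decidable using (_×-dec_; ¬?; dec-true; decidable-stable; map′)
open import Relation.Unary using (Decidable)
open Inverse using (to; from)

-- Lists without repetition.

Linked-∷ʳ⁻ : ∀ {A : Set} {R : Rel A 0ℓ} xs {z : A} {zs} →
  Linked R (xs ++ z ∷ zs) → Linked R (xs ∷ʳ z)
Linked-∷ʳ⁻ []           _       = [-]
Linked-∷ʳ⁻ (x ∷ [])     (r ∷ _) = r ∷ [-]
Linked-∷ʳ⁻ (x ∷ y ∷ xs) (r ∷ l) = r ∷ Linked-∷ʳ⁻ (y ∷ xs) l

Unique-rotate⁻ : ∀ {A : Set} xs {z : A} {zs} → Unique (xs ++ z ∷ zs) → Unique (z ∷ xs)
Unique-rotate⁻ []       _ = [] ∷ []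
Unique-rotate⁻ (x ∷ xs) (x∉ ∷ u) with ++⁻ xs x∉ | Unique-rotate⁻ xs u
... | x∉xs , x≢z ∷ _ | z∉xs ∷ uxs = ((x≢z ∘ sym) ∷ z∉xs) ∷ x∉xs ∷ uxs

Unique⇒lookup-injective : ∀ {A : Set} {xs : List A} → Unique xs → Injective _≡_ _≡_ (lookup xs)
Unique⇒lookup-injective (_  ∷ _) {zero}  {zero}  _  = refl
Unique⇒lookup-injective (x∉ ∷ _) {zero}  {suc j} eq = contradiction eq (All.lookup x∉ (∈-lookup j))
Unique⇒lookup-injective (x∉ ∷ _) {suc i} {zero}  eq = contradiction (sym eq) (All.lookup x∉ (∈-lookup i))
Unique⇒lookup-injective (_  ∷ u) {suc i} {suc j} eq = cong suc (Unique⇒lookup-injective u eq)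

Unique⇒length≤ : ∀ {A : Set} {m} {f : A → Fin m} → Injective _≡_ _≡_ f →
  ∀ {xs} → Unique xs → length xs ≤ m
Unique⇒length≤ inj u = injective⇒≤ (Unique⇒lookup-injective u ∘ inj)

-- Adjacency, and the branches of a tree at a vertex.

Adj-sym : ∀ {V} (G : Graph V) {x y} → Graph.Adj G x y → Graph.Adj G y x
Adj-sym G {x} {y} = subst T (Graph.sym G x y)

Adj⇒≢ : ∀ {V} (G : Graph V) {x y} → Graph.Adj G x y → x ≢ y
Adj⇒≢ G {x} e refl = subst T (Graph.irrefl G x) e

module Rays {V : Set} (G : Graph V) (_≟_ : DecidableEquality V) (acyclic : Acyclic G) (u : V) where
  open Graph G using (Adj)

  -- Non-backtracking walks that leave u along the edge to b, by their current
  -- vertex and the one before it.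
  data Ray (b : V) : V → V → Set where
    start : Adj u b → Ray b b u
    step  : ∀ {h p z} → Ray b h p → Adj h z → z ≢ p → Ray b z h

  visited : ∀ {b h p} → Ray b h p → List V
  visited (start _)          = []
  visited (step {p = p} r _ _) = p ∷ visited r

  trail : ∀ {b h p} → Ray b h p → List V
  trail {h = h} {p} r = h ∷ p ∷ visited r

  trail-linked : ∀ {b h p} (r : Ray b h p) → Linked Adj (trail r)
  trail-linked (start e)    = Adj-sym G e ∷ [-]
  trail-linked (step r e _) = Adj-sym G e ∷ trail-linked r

  -- If `z` occurred beyond `p`, the trail up to that occurrence would close up to a cycle through
  -- `z`. Its further vertices include `h` and `p`, which gives the length that `Acyclic` asks for.
  fresh : ∀ {h p z ps} → Linked Adj (h ∷ p ∷ ps) → Unique (h ∷ p ∷ ps) →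
    Adj h z → z ≢ p → ¬ z ∈ₗ h ∷ p ∷ ps
  fresh l uq e z≢p (here refl)         = Adj⇒≢ G e refl
  fresh l uq e z≢p (there (here refl)) = z≢p refl
  fresh {h} {p} {z} l uq e z≢p (there (there z∈)) with ∈-∃++ z∈
  ... | as , bs , refl =
    acyclic z (h ∷ p ∷ as) (s≤s (s≤s z≤n)) (Unique-rotate⁻ (h ∷ p ∷ as) uq)
      (Adj-sym G e ∷ Linked-∷ʳ⁻ (h ∷ p ∷ as) l)

  trail-unique : ∀ {b h p} (r : Ray b h p) → Unique (trail r)
  trail-unique (start e) = ((Adj⇒≢ G e ∘ sym) ∷ []) ∷ [] ∷ []
  trail-unique (step r e z≢p) =
    ¬Any⇒All¬ _ (fresh (trail-linked r) (trail-unique r) e z≢p) ∷ trail-unique r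

  origin∈trail : ∀ {b h p} (r : Ray b h p) → u ∈ₗ p ∷ visited r
  origin∈trail (start _)    = here refl
  origin∈trail (step r _ _) = there (origin∈trail r)

  avoids : ∀ {b h p} → Ray b h p → h ≢ u
  avoids r refl with trail-unique r
  ... | h∉ ∷ _ = All.lookup h∉ (origin∈trail r) refl

  -- A ray of more than one edge could be prolonged along `e` to `u`, against `avoids`.
  last-edge : ∀ {b h p} → Ray b h p → Adj h u → h ≡ b
  last-edge (start _)         e = refl
  last-edge r@(step s _ _) e = contradiction refl (avoids (step r e (avoids s ∘ sym)))

  Branch : V → V → Set
  Branch b x = ∃[ p ] Ray b x p

  move : ∀ {b h z} → Branch b h → Adj h z → z ≢ u → Branch b z
  move {z = z} (p , r) e z≢u with z ≟ p
  move (p , r) e z≢u | no z≢p = _ , step r e z≢p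
  move (p , start _) e z≢u | yes refl = contradiction refl z≢u
  -- Going back to the previous vertex shortens the ray.
  move (p , step r _ _) e z≢u | yes refl = _ , r

  -- Follow the second ray backwards, staying in the branch of `b`, until `c` is reached; as `c` is
  -- adjacent to `u`, `last-edge` applies.
  branch-unique : ∀ {b c x} → Branch b x → Branch c x → b ≡ c
  branch-unique B (_ , r) = go B r
    where
    go : ∀ {b c x p} → Branch b x → Ray c x p → b ≡ c
    go B (start e)    = sym (last-edge (proj₂ B) (Adj-sym G e))
    go B (step r e _) = go (move B (Adj-sym G e) (avoids r)) r

  branch : ∀ {x} → Star Adj x u → x ≢ u → ∃[ b ] (Adj u b × Branch b x)
  branch ε x≢u = contradiction refl x≢u
  branch {x} (_◅_ {j = y} e w) x≢u with y ≟ u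
  ... | yes refl = x , Adj-sym G e , _ , start (Adj-sym G e)
  ... | no y≢u with branch w y≢u
  ...   | b , e′ , B = b , e′ , move B (Adj-sym G e) x≢u

  -- A walk can leave the branch only by entering `u`, and by `last-edge` it does so along the
  -- removed edge.
  separated : ∀ {b x} → Branch b x → ¬ Star (RemoveEdge G u b) x u
  separated (_ , r) ε = avoids r refl
  separated (p , r) (_◅_ {j = y} (e , _ , kept) w) with y ≟ u
  ... | yes refl = kept (last-edge r e , refl)
  ... | no y≢u   = separated (move (p , r) e y≢u) w

  -- The ray itself, traversed backwards, enters `u` from `c` and thus keeps off the edge to `b`.
  unseparated : ∀ {b c x} → b ≢ c → Branch c x → Star (RemoveEdge G u b) x u
  unseparated {b} {c} b≢c (_ , r) = go r
    where
    go : ∀ {x p} → Ray c x p → Star (RemoveEdge G u b) x u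
    go (start e) = (Adj-sym G e , Adj⇒≢ G e ∘ sym ∘ proj₁ , b≢c ∘ sym ∘ proj₁) ◅ ε
    go r@(step r′ e _) =
      (Adj-sym G e , avoids r ∘ proj₁ , avoids r′ ∘ proj₂) ◅ go r′

-- Finiteness of the vertex set of the tree, and neighbours.

leaf-injective : ∀ {n k l m} → leaf {n} {k} l ≡ leaf m → l ≡ m
leaf-injective refl = refl

node-injective : ∀ {n k u v} → node {n} {k} u ≡ node v → u ≡ v
node-injective refl = refl

_≟ᵛ_ : ∀ {n k} → DecidableEquality (TreeVertex n k)
leaf l ≟ᵛ leaf m = map′ (cong leaf) leaf-injective (l ≟ m)
leaf l ≟ᵛ node v = no λ ()
node u ≟ᵛ leaf m = no λ ()
node u ≟ᵛ node v = map′ (cong node) node-injective (u ≟ v)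

toSum : ∀ {n k} → TreeVertex n k → Fin n ⊎ Fin k
toSum (leaf l) = inj₁ l
toSum (node u) = inj₂ u

toSum-injective : ∀ {n k} → Injective _≡_ _≡_ (toSum {n} {k})
toSum-injective {x = leaf l} {leaf m} refl = refl
toSum-injective {x = node u} {node v} refl = refl

toFin : ∀ {n k} → TreeVertex n k → Fin (n + k)
toFin {n} {k} = join n k ∘ toSum

toFin-injective : ∀ {n k} → Injective _≡_ _≡_ (toFin {n} {k})
toFin-injective {n} {k} {x} {y} eq = toSum-injective (begin
  toSum x                   ≡⟨ splitAt-join n k (toSum x) ⟨
  splitAt n (toFin x)       ≡⟨ cong (splitAt n) eq ⟩
  splitAt n (toFin y)       ≡⟨ splitAt-join n k (toSum y) ⟩
  toSum y                   ∎)
  where open ≡-Reasoning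

↔-injective : ∀ {A B : Set} (f : A ↔ B) → Injective _≡_ _≡_ (to f)
↔-injective f = Injection.injective (↔⇒↣ f)

Neighbour-≡ : ∀ {V} (G : Graph V) {x} {y z : Graph.Neighbour G x} → proj₁ y ≡ proj₁ z → y ≡ z
Neighbour-≡ G refl = cong (_ ,_) (T-irrelevant _ _)

another-neighbour : ∀ {V} (G : Graph V) → DecidableEquality V → ∀ {x d} → 3 ≤ d → HasDegree G x d →
  ∀ y → ∃[ z ] (Graph.Adj G x z × z ≢ y)
another-neighbour G _≟_ (s≤s (s≤s _)) deg y with proj₁ (from deg zero) ≟ y
... | no  z≢y = _ , proj₂ (from deg zero) , z≢y
... | yes z≡y = _ , proj₂ (from deg (suc zero)) , λ z′≡y →
  contradiction (↔-injective (↔-sym deg) (Neighbour-≡ G (trans z≡y (sym z′≡y)))) λ ()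

-- Alternating walks in a graph-labelled tree.

module _ {n k : ℕ} (Γ : GLT n k) where
  open GLT Γ
  open Graph tree using (Adj)

  node-neighbour : ∀ v y → ∃[ z ] (Adj (node v) z × z ≢ y)
  node-neighbour v with nodeDegree v
  ... | d , 3≤d , deg = another-neighbour tree _≟ᵛ_ 3≤d deg

  flip-step : ∀ {κ x y} → Step κ x y → Step κ y x
  flip-step (along e e′)   = along e′ e
  flip-step (within {u} e) = within (Adj-sym (label u) e)

  other-involutive : ∀ κ → other (other κ) ≡ κ
  other-involutive treeEdge  = refl
  other-involutive labelEdge = refl

  -- Reversal with an accumulator: `back` begins with the kind opposite to that of the next step, so
  -- the flipped step goes in front of it without breaking the alternation.
  reverse-onto : ∀ {κ x y z} → Alternating κ x y → Alternating (other κ) x z → Accessible y z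
  reverse-onto []                    back = _ , back
  reverse-onto {κ} (_∷_ {y = y} s w) back = reverse-onto w
    (subst (λ κ → Alternating κ y _) (sym (other-involutive κ)) (flip-step s ∷ back))

  position : Element → TreeVertex n k
  position (leaf l)     = leaf l
  position (marker v _) = node v

  position-extremity : ∀ a b (e : Adj a b) → position (extremity a b e) ≡ a
  position-extremity (leaf l) b e = refl
  position-extremity (node v) b e = refl

  position-adj : ∀ {x y} → Step treeEdge x y → Adj (position x) (position y)
  position-adj (along {a} {b} e e′) =
    subst₂ Adj (sym (position-extremity a b e)) (sym (position-extremity b a e′)) e

  -- The indices of `along` are applications of `extremity`, which do not unify with `marker v t`;
  -- this view records the match as an equation between marker vertices.
  data FromMarker v (t : Fin (size v)) : Element → Set where
    via : ∀ {b} (e : Adj (node v) b) (e′ : Adj b (node v)) → t ≡ to (ρ v) (b , e) →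
          FromMarker v t (extremity b (node v) e′)

  from-marker : ∀ {v t y} → Step treeEdge (marker v t) y → FromMarker v t y
  from-marker s = go s refl
    where
    go : ∀ {x v t y} → Step treeEdge x y → x ≡ marker v t → FromMarker v t y
    go (along {node v} e e′) refl = via e e′ refl

  module AtNode (u : Fin k) where
    open Rays tree _≟ᵛ_ acyclic (node u)

    -- An alternating walk never backtracks in the tree: it leaves a node by
    -- another marker vertex than the one by which it has entered it.
    outgoing : ∀ {b h p l} → Ray b h p → (e : Adj h p) →
      Alternating labelEdge (extremity h p e) (leaf l) → Branch b (leaf l)
    outgoing {h = leaf _} r e []      = _ , r
    outgoing {h = node v} {p} r e (within a ∷ (s ∷ w)) with from-marker s
    ... | via {c} e₁ e₂ refl = outgoing (step r e₁ c≢p) e₂ w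
      where
      -- Otherwise entry and exit would be the same marker vertex and `a` a loop.
      c≢p : c ≢ p
      c≢p c≡p = Adj⇒≢ (label v) a (cong (to (ρ v)) (Neighbour-≡ tree (sym c≡p)))

    leaf-branch : ∀ l → ∃[ b ] (Adj (node u) b × Branch b (leaf l))
    leaf-branch l = branch (connected (leaf l) (node u)) λ ()

    -- The sets `L u q` partition the leaves, and `part l` is the marker vertex whose class contains
    -- `l`.
    part : Fin n → Fin (size u)
    part l = to (ρ u) (proj₁ (leaf-branch l) , proj₁ (proj₂ (leaf-branch l)))

    part-unique : ∀ {b l} → Branch b (leaf l) → (e : Adj (node u) b) → part l ≡ to (ρ u) (b , e)
    part-unique {l = l} B e =
      cong (to (ρ u)) (Neighbour-≡ tree (branch-unique (proj₂ (proj₂ (leaf-branch l))) B))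

    exit : ∀ {r l} → Alternating treeEdge (marker u r) (leaf l) → part l ≡ r
    exit (s ∷ w) with from-marker s
    ... | via e e′ refl = part-unique (outgoing (start e) e′ w) e

    L⇒part : ∀ {q l} → L u q l → part l ≡ q
    L⇒part {q} {l} l∈L with proj₁ (from (ρ u) q) ≟ᵛ proj₁ (leaf-branch l)
    ... | no  b≢c = contradiction (unseparated b≢c (proj₂ (proj₂ (leaf-branch l)))) l∈L
    ... | yes b≡c = trans (cong (to (ρ u)) (Neighbour-≡ tree (sym b≡c))) (Inverse.strictlyInverseˡ (ρ u) q)

    part⇒L : ∀ l → L u (part l) l
    part⇒L l = separated (subst (λ y → Branch (proj₁ y) (leaf l))
      (sym (Inverse.strictlyInverseʳ (ρ u) _)) (proj₂ (proj₂ (leaf-branch l))))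

    A⇒part : ∀ {q l} → A u q l → part l ≡ q
    A⇒part (l∈L , _) = L⇒part l∈L

    -- A walk starting with a label-edge from `q` to `r` would leave `u` through `r`, so that `l`
    -- would lie in the part `r` and not in `q`.
    A-walk : ∀ {q l} → A u q l → Alternating treeEdge (marker u q) (leaf l)
    A-walk (_   , treeEdge , w) = w
    A-walk (l∈L , labelEdge , within a ∷ w) =
      contradiction (trans (sym (L⇒part l∈L)) (exit w)) (Adj⇒≢ (label u) a)

    walk⇒A : ∀ {q l} → Alternating treeEdge (marker u q) (leaf l) → A u q l
    walk⇒A {l = l} w = subst (λ q → L u q l) (exit w) (part⇒L l) , _ , w

    join-accessible : ∀ {q r x y} → A u q x → A u r y → Graph.Adj (label u) q r →
      Accessible (leaf x) (leaf y)
    join-accessible x∈ y∈ a = reverse-onto (A-walk x∈) (within a ∷ A-walk y∈)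

    Crossing : Fin n → Fin n → Set
    Crossing x y = ∃[ q ] ∃[ r ] (A u q x × A u r y × Graph.Adj (label u) q r)

    -- As long as the walk from `x` has not met `u`, it stays in one branch. When it meets `u`, the
    -- reversed past `back` and the remaining walk both lead away from `u`, and the label-edge
    -- between them is the one sought.
    incoming : ∀ {b z x y} → Branch b (position z) → Alternating labelEdge z (leaf x) →
      Alternating treeEdge z (leaf y) → Branch b (leaf y) ⊎ Crossing x y
    incoming B back []       = inj₁ B
    incoming B back (s ∷ []) = inj₁ (move B (position-adj s) λ ())
    incoming B back (s ∷ (within {v} a ∷ w)) with v ≟ u
    ... | yes refl = inj₂ (_ , _ , walk⇒A (flip-step s ∷ back) , walk⇒A w , a)
    ... | no  v≢u  = incoming (move B (position-adj s) (v≢u ∘ node-injective))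
                       (within (Adj-sym (label v) a) ∷ (flip-step s ∷ back)) w

    crossing : ∀ {x y} → Accessible (leaf x) (leaf y) → part x ≢ part y → Crossing x y
    -- No label-edge starts at a leaf, so this walk is empty.
    crossing (labelEdge , []) x≁y = contradiction refl x≁y
    crossing {x} (treeEdge , w) x≁y with incoming (proj₂ (proj₂ (leaf-branch x))) [] w
    ... | inj₂ c = c
    ... | inj₁ B = contradiction (sym (part-unique B (proj₁ (proj₂ (leaf-branch x))))) x≁y

    -- A ray ending at a node can be prolonged. The fuel `f` suffices because a trail has no
    -- repetition and the tree has `n + k` vertices.
    leaf-beyond : ∀ f {b h p} (r : Ray b h p) → n + k < length (trail r) + f →
      ∃[ l ] Branch b (leaf l)
    leaf-beyond f {h = leaf l} r _ = l , _ , r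
    leaf-beyond zero r lt =
      contradiction (Unique⇒length≤ toFin-injective (trail-unique r)) (<⇒≱ (subst (n + k <_) (+-identityʳ _) lt))
    leaf-beyond (suc f) {h = node v} {p} r lt with node-neighbour v p
    ... | z , e , z≢p = leaf-beyond f (step r e z≢p) (subst (n + k <_) (+-suc _ f) lt)

    part-surjective : ∀ q → ∃[ l ] part l ≡ q
    part-surjective q with from (ρ u) q in eq
    ... | b , e with leaf-beyond (n + k) (start e) (s≤s (m≤n+m (n + k) 1))
    ...   | l , B = l , trans (part-unique B e) (Inverse.inverseˡ (ρ u) (sym eq))

    another-marker : ∀ q → ∃[ r ] r ≢ q
    another-marker q with node-neighbour u (proj₁ (from (ρ u) q))
    ... | z , e , z≢ = to (ρ u) (z , e) , λ eq →
      z≢ (sym (cong proj₁ (Inverse.inverseʳ (ρ u) (sym eq))))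

-- Lexicographic comparison of labels.

-- The two lists agree up to a point where the second one continues with x, and
-- the first one either stops or continues with something smaller.
data Below (x : ℕ) : List ℕ → List ℕ → Set where
  stop  : ∀ {ys} → Below x [] (x ∷ ys)
  lower : ∀ {y xs ys} → y < x → Below x (y ∷ xs) (x ∷ ys)
  skip  : ∀ {z xs ys} → Below x xs ys → Below x (z ∷ xs) (z ∷ ys)

appendIf : Bool → ℕ → List ℕ → List ℕ
appendIf b y xs = if b then xs ∷ʳ y else xs

Below-∷ʳ : ∀ x xs → Below x xs (xs ∷ʳ x)
Below-∷ʳ x []       = stop
Below-∷ʳ x (z ∷ xs) = skip (Below-∷ʳ x xs)

-- The appended `y` can matter only if the first list stops at the deciding point; there it meets
-- `x`, which is larger.
Below-appendIfˡ : ∀ {x y xs ys} b → y < x → Below x xs ys → Below x (appendIf b y xs) ys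
Below-appendIfˡ false y<x B         = B
Below-appendIfˡ true  y<x stop      = lower y<x
Below-appendIfˡ true  y<x (lower p) = lower p
Below-appendIfˡ true  y<x (skip B)  = skip (Below-appendIfˡ true y<x B)

Below-appendIfʳ : ∀ {x y xs ys} b → Below x xs ys → Below x xs (appendIf b y ys)
Below-appendIfʳ false B         = B
Below-appendIfʳ true  stop      = stop
Below-appendIfʳ true  (lower p) = lower p
Below-appendIfʳ true  (skip B)  = skip (Below-appendIfʳ true B)

Below⇒≤ : ∀ {x xs ys} → Below x xs ys → xs ≤ₗₑₓ ys
Below⇒≤ stop      = halt
Below⇒≤ (lower p) = this p
Below⇒≤ (skip B)  = next refl (Below⇒≤ B)

Below⇒≱ : ∀ {x xs ys} → Below x xs ys → ¬ ys ≤ₗₑₓ xs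
Below⇒≱ (lower y<x) (this x<y)   = <-asym y<x x<y
Below⇒≱ (lower y<x) (next refl _) = <-irrefl refl y<x
Below⇒≱ (skip B)    (this z<z)   = <-irrefl refl z<z
Below⇒≱ (skip B)    (next _ l)   = Below⇒≱ B l

≤ₗₑₓ-reflexive : ∀ {xs ys} → xs ≡ ys → xs ≤ₗₑₓ ys
≤ₗₑₓ-reflexive {[]}     refl = base tt
≤ₗₑₓ-reflexive {_ ∷ _} refl = next refl (≤ₗₑₓ-reflexive refl)

-- The four-point characterisation of LBFS orderings.

module FourPoints {n : ℕ} (G : Graph (Fin n)) (num : Fin n ↔ Fin n) where
  open Graph G using (adj; Adj)

  pos : Fin n → ℕ
  pos = toℕ ∘ to num

  pos-injective : ∀ {x y} → pos x ≡ pos y → x ≡ y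
  pos-injective eq = ↔-injective num (toℕ-injective eq)

  at : ∀ {j} → j < n → Fin n
  at j<n = from num (fromℕ< j<n)

  pos-at : ∀ {j} (j<n : j < n) → pos (at j<n) ≡ j
  pos-at j<n = trans (cong toℕ (Inverse.strictlyInverseˡ num _)) (toℕ-fromℕ< j<n)

  FourPoint : Set
  FourPoint = ∀ {a b c} → pos a < pos b → pos b < pos c → Adj a c → ¬ Adj a b →
    ∃[ d ] (pos d < pos a × Adj d b × ¬ Adj d c)

  Agree : ℕ → Fin n → Fin n → Set
  Agree j v w = ∀ d → pos d < j → adj d v ≡ adj d w

  -- `d` is the first vertex to distinguish `v` from `w`. Its entry `n ∸ pos d` exceeds all later
  -- ones, so the lead of `v` persists while both are unnumbered.
  Ahead : ∀ j → j ≤ n → Fin n → Fin n → Set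
  Ahead j j≤n v w = ∃[ d ] (pos d < j × Adj d v × ¬ Adj d w × Agree (pos d) v w ×
    Below (n ∸ pos d) (lbfsLabel G num j j≤n w) (lbfsLabel G num j j≤n v))

  data Comparison j (j≤n : j ≤ n) v w : Set where
    same   : Agree j v w → lbfsLabel G num j j≤n v ≡ lbfsLabel G num j j≤n w → Comparison j j≤n v w
    first  : Ahead j j≤n v w → Comparison j j≤n v w
    second : Ahead j j≤n w v → Comparison j j≤n v w

  label-suc : ∀ j (j<n : j < n) w → j < pos w →
    lbfsLabel G num (suc j) j<n w ≡ appendIf (adj (at j<n) w) (n ∸ j) (lbfsLabel G num j (<⇒≤ j<n) w)
  label-suc j j<n w j<w rewrite dec-true (j <? pos w) j<w = refl

  ahead-suc : ∀ j (j<n : j < n) {v w} → j < pos v → j < pos w →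
    Ahead j (<⇒≤ j<n) v w → Ahead (suc j) j<n v w
  ahead-suc j j<n {v} {w} j<v j<w (d , d<j , dv , dw , agree , B) =
    d , m<n⇒m<1+n d<j , dv , dw , agree ,
    subst₂ (Below _) (sym (label-suc j j<n w j<w)) (sym (label-suc j j<n v j<v))
      (Below-appendIfˡ (adj (at j<n) w) (∸-monoʳ-< d<j (<⇒≤ j<n))
        (Below-appendIfʳ (adj (at j<n) v) B))

  ahead-new : ∀ j (j<n : j < n) {v w} → j < pos v → j < pos w → Agree j v w →
    lbfsLabel G num j (<⇒≤ j<n) v ≡ lbfsLabel G num j (<⇒≤ j<n) w →
    adj (at j<n) v ≡ true → adj (at j<n) w ≡ false → Ahead (suc j) j<n v w
  ahead-new j j<n {v} {w} j<v j<w agree eq cv cw =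
    at j<n , s≤s (≤-reflexive (pos-at j<n)) , subst T (sym cv) tt , subst T cw ,
    subst (λ i → Agree i v w) (sym (pos-at j<n)) agree , below
    where
    below : Below (n ∸ pos (at j<n)) (lbfsLabel G num (suc j) j<n w) (lbfsLabel G num (suc j) j<n v)
    below rewrite label-suc j j<n w j<w | label-suc j j<n v j<v | cv | cw | eq | pos-at j<n =
      Below-∷ʳ _ _

  same-suc : ∀ j (j<n : j < n) {v w} → j < pos v → j < pos w → Agree j v w →
    lbfsLabel G num j (<⇒≤ j<n) v ≡ lbfsLabel G num j (<⇒≤ j<n) w →
    adj (at j<n) v ≡ adj (at j<n) w → Comparison (suc j) j<n v w
  same-suc j j<n {v} {w} j<v j<w agree eq cvw = same agree′
    (trans (label-suc j j<n v j<v)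
      (trans (cong₂ (λ b → appendIf b (n ∸ j)) cvw eq) (sym (label-suc j j<n w j<w))))
    where
    agree′ : Agree (suc j) v w
    agree′ d d<1+j with m≤n⇒m<n∨m≡n (≤-pred d<1+j)
    ... | inj₁ d<j  = agree d d<j
    ... | inj₂ refl with pos-injective (pos-at j<n)
    ...   | eq′ = subst (λ c → adj c v ≡ adj c w) eq′ cvw

  -- Labels remain equal until some numbered vertex distinguishes `v` from `w`; the first that does
  -- so decides the comparison.
  compare : ∀ j (j≤n : j ≤ n) v w → j ≤ pos v → j ≤ pos w → Comparison j j≤n v w
  compare zero    _   v w _   _   = same (λ _ ()) refl
  compare (suc j) j<n v w j<v j<w with compare j (<⇒≤ j<n) v w (<⇒≤ j<v) (<⇒≤ j<w)
  ... | first  A = first  (ahead-suc j j<n j<v j<w A)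
  ... | second A = second (ahead-suc j j<n j<w j<v A)
  ... | same agree eq with adj (at j<n) v in cv | adj (at j<n) w in cw
  ...   | true  | false = first  (ahead-new j j<n j<v j<w agree eq cv cw)
  ...   | false | true  = second (ahead-new j j<n j<w j<v (λ d → sym ∘ agree d) (sym eq) cw cv)
  ...   | true  | true  = same-suc j j<n j<v j<w agree eq (trans cv (sym cw))
  ...   | false | false = same-suc j j<n j<v j<w agree eq (trans cv (sym cw))

  -- When `b` is numbered, `a` already distinguishes `b` from `c`, and `b` is not behind. Hence the
  -- first distinguishing vertex `d` favours `b`; since `a` favours `c`, `d` comes before `a`.
  LBFS⇒FourPoint : IsLBFSNumbering G num → FourPoint
  LBFS⇒FourPoint lbfs {a} {b} {c} a<b b<c ac ab = from-comparison
    (compare j (<⇒≤ j<n) v c (≤-reflexive (sym (pos-at j<n))) (<⇒≤ b<c))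
    where
    j = pos b
    j<n = toℕ<n (to num b)
    v = at j<n
    v≡b : v ≡ b
    v≡b = pos-injective (pos-at j<n)
    from-comparison : Comparison j (<⇒≤ j<n) v c →
      ∃[ d ] (pos d < pos a × Adj d b × ¬ Adj d c)
    from-comparison cmp rewrite v≡b with cmp
    ... | same agree _ = contradiction (subst T (sym (agree a a<b)) ac) ab
    ... | second (_ , _ , _ , _ , _ , B) = contradiction
      (subst (λ v → lbfsLabel G num j (<⇒≤ j<n) c ≤ₗₑₓ lbfsLabel G num j (<⇒≤ j<n) v) v≡b
        (lbfs j j<n c (<⇒≤ b<c))) (Below⇒≱ B)
    ... | first (d , _ , db , dc , agree , _) with <-cmp (pos d) (pos a)
    ...   | tri< d<a _ _ = d , d<a , db , dc
    ...   | tri> _ _ a<d = contradiction (subst T (sym (agree a a<d)) ac) ab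
    ...   | tri≈ _ d≡a _ with refl ← pos-injective d≡a = contradiction db ab

  -- If `w` were ahead of the chosen vertex, apply the four-point condition to the first vertex `a`
  -- that distinguishes them: it yields a distinguishing vertex before `a`.
  FourPoint⇒LBFS : FourPoint → IsLBFSNumbering G num
  FourPoint⇒LBFS four j j<n w j≤w
    with compare j (<⇒≤ j<n) (at j<n) w (≤-reflexive (sym (pos-at j<n))) j≤w
  ... | same _ eq = ≤ₗₑₓ-reflexive (sym eq)
  ... | first (_ , _ , _ , _ , _ , B) = Below⇒≤ B
  ... | second (a , a<j , aw , av , agree , _) with m≤n⇒m<n∨m≡n j≤w
  ...   | inj₂ j≡w with refl ← pos-injective {at j<n} {w} (trans (pos-at j<n) j≡w) = ≤ₗₑₓ-reflexive refl
  ...   | inj₁ j<w with four (subst (pos a <_) (sym (pos-at j<n)) a<j)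
                         (subst (_< pos w) (sym (pos-at j<n)) j<w) aw av
  ...     | d , d<a , dv , dw = contradiction (subst T (sym (agree d d<a)) dv) dw

-- Numberings obtained from injective functions.

injective-surjective : ∀ {m} {f : Fin m → Fin m} → Injective _≡_ _≡_ f → ∀ i → ∃[ j ] f j ≡ i
injective-surjective {suc m} {f} inj i with any? (λ j → f j ≟ i)
... | yes hit = hit
-- Punching out the missed value `i` leaves an injection into a smaller set.
... | no miss = contradiction (injective⇒≤ {f = λ j → punchOut (i≢f j)} λ eq →
    inj (punchOut-injective (i≢f _) (i≢f _) eq)) 1+n≰n
  where
  i≢f : ∀ j → i ≢ f j
  i≢f j i≡fj = miss (j , sym i≡fj)

injective⇒↔ : ∀ {m} {f : Fin m → Fin m} → Injective _≡_ _≡_ f → Fin m ↔ Fin m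
injective⇒↔ {f = f} inj = mk↔ₛ′ f (proj₁ ∘ injective-surjective inj)
  (proj₂ ∘ injective-surjective inj) (λ i → inj (proj₂ (injective-surjective inj (f i))))

module Ranking {m : ℕ} (f : Fin m → ℕ) (f-injective : Injective _≡_ _≡_ f) where

  smaller : Fin m → Subset m
  smaller q = tabulate λ r → does (f r <? f q)

  ∈-smaller⁺ : ∀ {q r} → f r < f q → r ∈ smaller q
  ∈-smaller⁺ {q} {r} fr<fq =
    lookup⇒[]= r _ (trans (lookup∘tabulate _ r) (dec-true (f r <? f q) fr<fq))

  ∈-smaller⁻ : ∀ {q r} → r ∈ smaller q → f r < f q
  ∈-smaller⁻ {q} {r} r∈ =
    <ᵇ⇒< (f r) (f q) (subst T (trans (sym ([]=⇒lookup r∈)) (lookup∘tabulate _ r)) tt)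

  smaller-mono : ∀ {q r} → f q < f r → ∣ smaller q ∣ < ∣ smaller r ∣
  smaller-mono {q} fq<fr = p⊂q⇒∣p∣<∣q∣
    ((λ s∈ → ∈-smaller⁺ (<-trans (∈-smaller⁻ s∈) fq<fr)) ,
     q , ∈-smaller⁺ fq<fr , <-irrefl refl ∘ ∈-smaller⁻)

  smaller-bound : ∀ q → ∣ smaller q ∣ < m
  smaller-bound q = subst (∣ smaller q ∣ <_) (∣⊤∣≡n m)
    (p⊂q⇒∣p∣<∣q∣ ((λ _ → ∈⊤) , q , ∈⊤ , <-irrefl refl ∘ ∈-smaller⁻))

  -- Counting the smaller values makes positions consecutive, as a numbering requires.
  rank : Fin m → Fin m
  rank q = fromℕ< (smaller-bound q)

  rank-mono : ∀ {q r} → f q < f r → rank q Fin.< rank r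
  rank-mono fq<fr = subst₂ _<_ (sym (toℕ-fromℕ< _)) (sym (toℕ-fromℕ< _)) (smaller-mono fq<fr)

  rank-cancel : ∀ {q r} → rank q Fin.< rank r → f q < f r
  rank-cancel {q} {r} lt with <-cmp (f q) (f r)
  ... | tri< fq<fr _ _ = fq<fr
  ... | tri≈ _ fq≡fr _ with refl ← f-injective fq≡fr = contradiction lt (<-irrefl refl)
  ... | tri> _ _ fr<fq = contradiction lt (<-asym (rank-mono fr<fq))

  rank-injective : Injective _≡_ _≡_ rank
  rank-injective {q} {r} eq with <-cmp (f q) (f r)
  ... | tri< fq<fr _ _ = contradiction (rank-mono fq<fr) (<-irrefl (cong toℕ eq))
  ... | tri≈ _ fq≡fr _ = f-injective fq≡fr
  ... | tri> _ _ fr<fq = contradiction (rank-mono fr<fq) (<-irrefl (cong toℕ (sym eq)))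

  ranking : Fin m ↔ Fin m
  ranking = injective⇒↔ rank-injective

-- Minima, boundary edges and earlier neighbours.

least : ∀ {n} {P : Fin n → Set} → Decidable P → (f : Fin n → ℕ) → ∃[ x ] P x →
  ∃[ x ] (P x × ∀ y → P y → f x ≤ f y)
least {P = P} P? f (x , px) = go x px (<-wellFounded (f x))
  where
  go : ∀ x → P x → Acc _<_ (f x) → ∃[ x ] (P x × ∀ y → P y → f x ≤ f y)
  go x px (acc rec) with any? (λ y → P? y ×-dec (f y <? f x))
  ... | yes (y , py , fy<fx) = go y py (rec fy<fx)
  ... | no  none = x , px , λ y py → ≮⇒≥ λ fy<fx → none (y , py , fy<fx)

exit-edge : ∀ {V : Set} {R : Rel V 0ℓ} {P : V → Set} → Decidable P → ∀ {x y} → Star R x y →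
  P x → ¬ P y → ∃[ a ] ∃[ b ] (R a b × P a × ¬ P b)
exit-edge P? ε px ¬py = contradiction px ¬py
exit-edge P? (_◅_ {j = z} e w) px ¬py with P? z
... | yes pz = exit-edge P? w pz ¬py
... | no ¬pz = _ , z , e , px , ¬pz

module Search {n : ℕ} (G : Graph (Fin n)) (connected : Connected G) (num : Fin n ↔ Fin n)
  (four : FourPoints.FourPoint G num) where
  open Graph G using (adj; Adj)
  open FourPoints G num using (pos; at; pos-at; pos-injective)

  -- By connectedness some edge `ac` leads from before `v` to a vertex not before `v`. If `a` is not
  -- adjacent to `v`, then `c` comes after `v`, and the four-point condition for `a`, `v`, `c` gives
  -- a neighbour of `v` before `a`. So every initial segment of the ordering is connected.
  earlier-neighbour : ∀ v → 0 < pos v → ∃[ d ] (pos d < pos v × Adj d v)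
  earlier-neighbour v 0<v with any? (λ d → (pos d <? pos v) ×-dec T? (adj d v))
  ... | yes found = found
  ... | no  none = contradiction (d , <-trans d<a a<v , dv) none
    where
    0<n : 0 < n
    0<n = <-trans 0<v (toℕ<n (to num v))
    crossing : ∃[ a ] ∃[ c ] (Adj a c × pos a < pos v × ¬ pos c < pos v)
    crossing = exit-edge (λ x → pos x <? pos v) (connected (at 0<n) v)
      (subst (_< pos v) (sym (pos-at 0<n)) 0<v) (<-irrefl refl)
    a = proj₁ crossing
    c = proj₁ (proj₂ crossing)
    ac : Adj a c
    ac = proj₁ (proj₂ (proj₂ crossing))
    a<v : pos a < pos v
    a<v = proj₁ (proj₂ (proj₂ (proj₂ crossing)))
    av : ¬ Adj a v
    av e = none (a , a<v , e)
    v<c : pos v < pos c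
    v<c = ≤∧≢⇒< (≮⇒≥ (proj₂ (proj₂ (proj₂ (proj₂ crossing)))))
      (λ v≡c → av (subst (Adj a) (sym (pos-injective v≡c)) ac))
    found = four a<v v<c ac av
    d = proj₁ found
    d<a = proj₁ (proj₂ found)
    dv = proj₁ (proj₂ (proj₂ found))

-- From an LBFS ordering of a graph to one of its quotient by parts.

module Quotient {n m : ℕ} (G : Graph (Fin n)) (connected : Connected G) (H : Graph (Fin m))
  (part : Fin n → Fin m) (part-surjective : ∀ q → ∃[ x ] part x ≡ q) (another : (q : Fin m) → ∃[ r ] r ≢ q)
  (A : Fin m → Fin n → Set) (A⇒part : ∀ {q x} → A q x → part x ≡ q)
  (crossing : ∀ {x y} → Graph.Adj G x y → part x ≢ part y →
    ∃[ q ] ∃[ r ] (A q x × A r y × Graph.Adj H q r))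
  (joined : ∀ {q r x y} → A q x → A r y → Graph.Adj H q r → Graph.Adj G x y)
  (_≺_ : Rel (Fin n) 0ℓ) (lbfs : IsLBFSOrdering G _≺_) where
  open Graph G using (adj; Adj)

  num = proj₁ lbfs
  open FourPoints G num
  four = LBFS⇒FourPoint (proj₁ (proj₂ lbfs))
  open Search G connected num four

  crossing′ : ∀ {x y} → Adj x y → part x ≢ part y → A (part x) x × Graph.Adj H (part x) (part y)
  crossing′ e x≁y with crossing e x≁y
  ... | q , r , x∈ , y∈ , qr with refl ← A⇒part x∈ | refl ← A⇒part y∈ = x∈ , qr

  -- Some edge of the connected graph `G` leaves the part `q`, because there is another non-empty
  -- part. This makes `A q` non-empty, so that it has an earliest vertex.
  exit-from : ∀ q → ∃[ x ] ∃[ r ] ∃[ y ] (A q x × A r y × Graph.Adj H q r)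
  exit-from q with part-surjective q | another q
  ... | l , l∈ | q′ , q′≢q with part-surjective q′
  ...   | l′ , refl with exit-edge (λ x → part x ≟ q) (connected l l′) l∈ q′≢q
  ...     | x , y , e , refl , y∉ with crossing e (y∉ ∘ sym)
  ...       | _ , r , x∈ , y∈ , qr with refl ← A⇒part x∈ = x , r , y , x∈ , y∈ , qr

  -- A q consists of the vertices of the part q that have a neighbour outside it.
  A? : ∀ q → Decidable (A q)
  A? q x = map′ back forth ((part x ≟ q) ×-dec any? (λ y → ¬? (part y ≟ q) ×-dec T? (adj x y)))
    where
    back : part x ≡ q × ∃[ y ] (part y ≢ q × Adj x y) → A q x
    back (refl , y , y∉ , e) = proj₁ (crossing′ e (y∉ ∘ sym))
    forth : A q x → part x ≡ q × ∃[ y ] (part y ≢ q × Adj x y)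
    -- One vertex `y` serves for all of `A q`, since `joined` makes it adjacent to each of them.
    forth x∈ with exit-from q
    ... | _ , r , y , _ , y∈ , qr =
      A⇒part x∈ , y , (λ y∈q → Adj⇒≢ H qr (trans (sym y∈q) (A⇒part y∈))) , joined x∈ y∈ qr

  abstract
    earliest : ∀ q → ∃[ x ] (A q x × ∀ y → A q y → pos x ≤ pos y)
    earliest q = least (A? q) pos (proj₁ (exit-from q) , proj₁ (proj₂ (proj₂ (proj₂ (exit-from q)))))

  leader : Fin m → Fin n
  leader = proj₁ ∘ earliest

  leader∈A : ∀ q → A q (leader q)
  leader∈A = proj₁ ∘ proj₂ ∘ earliest

  leader-≤ : ∀ {q x} → A q x → pos (leader q) ≤ pos x
  leader-≤ {q} {x} = proj₂ (proj₂ (earliest q)) x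

  part-leader : ∀ q → part (leader q) ≡ q
  part-leader q = A⇒part (leader∈A q)

  time : Fin m → ℕ
  time = pos ∘ leader

  time-injective : Injective _≡_ _≡_ time
  time-injective {q} {r} eq =
    trans (sym (part-leader q)) (trans (cong part (pos-injective eq)) (part-leader r))

  crossing-leader : ∀ {x q} → Adj x (leader q) → part x ≢ q → A (part x) x × Graph.Adj H (part x) q
  crossing-leader {x} {q} e = subst (λ r → part x ≢ r → A (part x) x × Graph.Adj H (part x) r)
    (part-leader q) (crossing′ e)

  -- An edge leaving the part would put `x` into `A q`, yet `x` precedes the earliest vertex of
  -- `A q`.
  confined : ∀ {q x y} → Adj x y → pos x < time q → part x ≡ q → part y ≡ q
  confined {y = y} e x<q refl = decidable-stable (part y ≟ _) λ y∉ →
    <⇒≱ x<q (leader-≤ (proj₁ (crossing′ e (y∉ ∘ sym))))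

  -- The vertices preceding x_q form a connected graph without vertices of A q,
  -- so they are all in the part q or all outside it, according to the position
  -- of the vertex numbered first.
  initial : ∀ {q} x → pos x < time q → ∃[ s ] (pos s ≡ 0 × (part x ≡ q ⇔ part s ≡ q))
  initial {q} x = go x (<-wellFounded (pos x))
    where
    go : ∀ x → Acc _<_ (pos x) → pos x < time q → ∃[ s ] (pos s ≡ 0 × (part x ≡ q ⇔ part s ≡ q))
    go x (acc rec) x<q with pos x ≟ⁿ 0
    ... | yes x≡0 = x , x≡0 , mk⇔ (λ e → e) (λ e → e)
    ... | no  x≢0 with earlier-neighbour x (n≢0⇒n>0 x≢0)
    ...   | d , d<x , dx with go d (rec d<x) (<-trans d<x x<q)
    -- Both `x` and `d` precede the leader of `q`, so `confined` applies to their edge in either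
    -- direction.
    ...     | s , s≡0 , d⇔s = s , s≡0 , mk⇔
      (Equivalence.to d⇔s ∘ confined (Adj-sym G dx) x<q)
      (confined dx (<-trans d<x x<q) ∘ Equivalence.from d⇔s)

  one-sided : ∀ {q x y} → pos x < time q → pos y < time q → part x ≡ q → part y ≡ q
  one-sided {x = x} {y} x<q y<q x∈q with initial x x<q | initial y y<q
  ... | s , s≡0 , x⇔s | t , t≡0 , y⇔t with refl ← pos-injective (trans s≡0 (sym t≡0)) =
    Equivalence.from y⇔t (Equivalence.to x⇔s x∈q)

  time-four : ∀ {a b c} → time a < time b → time b < time c →
    Graph.Adj H a c → ¬ Graph.Adj H a b →
    ∃[ d ] (time d < time a × Graph.Adj H d b × ¬ Graph.Adj H d c)
  time-four {a} {b} {c} a<b b<c ac ab = from-witness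
    (four a<b b<c (joined (leader∈A a) (leader∈A c) ac) λ e →
      ab (subst (λ q → Graph.Adj H q b) (part-leader a) (proj₂ (crossing-leader e part-a≢b))))
    where
    part-a≢b : part (leader a) ≢ b
    part-a≢b eq = <-irrefl (cong time (trans (sym (part-leader a)) eq)) a<b

    from-witness : ∃[ d ] (pos d < time a × Adj d (leader b) × ¬ Adj d (leader c)) →
      ∃[ q ] (time q < time a × Graph.Adj H q b × ¬ Graph.Adj H q c)
    from-witness (d , d<a , db , dc) with part d ≟ b
    ... | yes d∈b = contradiction (one-sided (<-trans d<a a<b) a<b d∈b) part-a≢b
    ... | no  d∉b with crossing-leader db d∉b
    -- As `d` is in `A (part d)`, the leader of its part is no later than `d`; and an edge from
    -- `part d` to `c` would make `d` adjacent to `leader c`.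
    ...   | d∈ , qb = part d , ≤-<-trans (leader-≤ d∈) d<a , qb , dc ∘ joined d∈ (leader∈A c)

  open Ranking time time-injective

  quotient-four : FourPoints.FourPoint H ranking
  quotient-four a<b b<c ac ab =
    let d , d<a , db , dc = time-four (rank-cancel a<b) (rank-cancel b<c) ac ab
    in d , rank-mono d<a , db , dc

  -- Repeats the body of `Earliest` for a GLT, so that the relation in `quotient-lbfs` unfolds to
  -- the same one as `induced`.
  Earliest : Fin m → Fin n → Set
  Earliest q x = A q x × (∀ y → A q y → y ≢ x → x ≺ y)

  ≺⇔< : ∀ {x y} → x ≺ y ⇔ pos x < pos y
  ≺⇔< {x} {y} = proj₂ (proj₂ lbfs) x y

  leader-earliest : ∀ q → Earliest q (leader q)
  leader-earliest q = leader∈A q , λ y y∈ y≢ →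
    Equivalence.from ≺⇔< (≤∧≢⇒< (leader-≤ y∈) (y≢ ∘ sym ∘ pos-injective))

  earliest-unique : ∀ {q x} → Earliest q x → x ≡ leader q
  earliest-unique {q} {x} (x∈ , x≺) with leader q ≟ x
  ... | yes eq = sym eq
  ... | no neq = contradiction (leader-≤ x∈) (<⇒≱ (Equivalence.to ≺⇔< (x≺ _ (leader∈A q) neq)))

  quotient-lbfs : IsLBFSOrdering H λ q r → ∃[ x ] ∃[ y ] (Earliest q x × Earliest r y × x ≺ y)
  quotient-lbfs = ranking , FourPoints.FourPoint⇒LBFS H ranking quotient-four , λ q r → mk⇔
    (λ { (x , y , Ex , Ey , x≺y) → rank-mono (subst₂ (λ x y → pos x < pos y)
         (earliest-unique Ex) (earliest-unique Ey) (Equivalence.to ≺⇔< x≺y)) })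
    (λ q<r → _ , _ , leader-earliest q , leader-earliest r , Equivalence.from ≺⇔< (rank-cancel q<r))

lemma3p6 : {n k : ℕ} (G : Graph (Fin n)) → Connected G →
    (σ : Rel (Fin n) 0ℓ) → IsLBFSOrdering G σ →
    (Γ : GLT n k) → IsAccessibilityGraph Γ G →
    (u : Fin k) → IsLBFSOrdering (GLT.label Γ u) (GLT.induced Γ σ u)
lemma3p6 G connected σ lbfs Γ accessible u =
  Quotient.quotient-lbfs G connected (GLT.label Γ u) part part-surjective another-marker
    (GLT.A Γ u) A⇒part
    (λ {x} {y} e → crossing (proj₂ (Equivalence.to (accessible x y) e)))
    (λ {q} {r} {x} {y} x∈ y∈ qr → Equivalence.from (accessible x y)
      -- Adjacency in `G` also demands distinct leaves: `x` and `y` lie in the parts `q` and `r`,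
      -- which differ because labels have no loops.
      ( (λ x≡y → Adj⇒≢ (GLT.label Γ u) qr (trans (sym (A⇒part x∈)) (trans (cong part x≡y) (A⇒part y∈))))
      , join-accessible x∈ y∈ qr))
    σ lbfs
  where open AtNode Γ u
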